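{- Let $G$ be a finite simple connected non-trivial graph (i.e. having at least two vertices) of order $n$, without pendent vertices. Then $$ABC(G)\le ABS(G),$$ with equality if and only if $G\cong C_n$, where $C_n$ is the $n$-vertex cycle.
   Context: For a finite simple graph $G$ with edge set $\mathbf{E}(G)$, let $d_u$ denote the degree of the vertex $u$ in $G$. The atom-bond-connectivity index is $ABC(G)=\sum_{uv\in \mathbf{E}(G)}\sqrt{\frac{d_u+d_v-2}{d_u d_v}}$ and the atom-bond sum-connectivity index is $ABS(G)=\sum_{uv\in \mathbf{E}(G)}\sqrt{\frac{d_u+d_v-2}{d_u+d_v}}$. A pendent vertex is a vertex of degree one. The order of a graph is its number of vertices. -}

module Defs where

open import Level using (0ℓ)
open import Data.Nat as ℕ using (ℕ; zero; suc)
import Data.Nat.Properties as ℕ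
import Data.Nat.DivMod as ℕ
open import Data.Integer as ℤ using (+_; -[1+_])
import Data.Integer.Properties as ℤ
open import Data.Rational as ℚ using (ℚ; 0ℚ; 1ℚ; _<_; _≤_; _+_; _*_; _-_; -_; 1/_; _⊓_)
import Data.Rational.Properties as ℚ
import Data.Rational.Unnormalised as ℚᵘ
import Data.Rational.Unnormalised.Properties as ℚᵘ
open import Data.Rational.Solver using (module +-*-Solver)
open import Data.Fin as Fin using (Fin; toℕ)
import Data.Fin.Properties as Fin
open import Data.List using (List; []; _∷_; length; filter; foldr; map; allFin; cartesianProduct)
open import Data.List.Membership.Propositional using (_∈_)
open import Data.List.Membership.Propositional.Properties using (∈-filter⁺; ∈-allFin)
open import Data.List.Relation.Unary.Any using (here; there)
import Data.List.Relation.Unary.All as All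
open import Data.List.Relation.Unary.All.Properties using (all-filter)
open import Data.Product using (Σ; ∃; ∃-syntax; Σ-syntax; _×_; _,_; proj₁; proj₂)
open import Data.Sum using (_⊎_; inj₁; inj₂; swap) renaming (map to map⊎)
open import Data.Empty using (⊥; ⊥-elim)
open import Function.Bundles using (_⇔_; _↔_; Inverse)
open import Relation.Nullary using (¬_; yes; no; contradiction)
open import Relation.Nullary.Decidable using (_×-dec_; _⊎-dec_)
open import Relation.Unary using () renaming (Decidable to Decidable₁)
open import Relation.Binary using (Rel; Decidable; Symmetric; Irreflexive; tri<; tri≈; tri>)
open import Relation.Binary.PropositionalEquality
open import Relation.Binary.Construct.Closure.ReflexiveTransitive using (Star)

0<q-p : ∀ {p q} → p < q → 0ℚ < q - p
0<q-p {p} {q} p<q = subst (_< q - p) (ℚ.+-inverseʳ p) (ℚ.+-monoˡ-< (- p) p<q)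

p-ε<p : ∀ p {ε} → 0ℚ < ε → p - ε < p
p-ε<p p {ε} 0<ε =
  subst (p - ε <_) (ℚ.+-identityʳ p) (ℚ.+-monoʳ-< p (ℚ.neg-antimono-< 0<ε))

p<p+ε : ∀ p {ε} → 0ℚ < ε → p < p + ε
p<p+ε p {ε} 0<ε = subst (_< p + ε) (ℚ.+-identityʳ p) (ℚ.+-monoʳ-< p 0<ε)

0≤p*q : ∀ {p q} → 0ℚ ≤ p → 0ℚ ≤ q → 0ℚ ≤ p * q
0≤p*q {p} {q} 0≤p 0≤q =
  subst (_≤ p * q) (ℚ.*-zeroʳ p) (ℚ.*-monoˡ-≤-nonNeg p {{ℚ.nonNegative 0≤p}} 0≤q)

square-mono-≤ : ∀ {p q} → 0ℚ ≤ p → p ≤ q → p * p ≤ q * q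
square-mono-≤ {p} {q} 0≤p p≤q = ℚ.≤-trans
  (ℚ.*-monoˡ-≤-nonNeg p {{ℚ.nonNegative 0≤p}} p≤q)
  (ℚ.*-monoʳ-≤-nonNeg q {{ℚ.nonNegative (ℚ.≤-trans 0≤p p≤q)}} p≤q)

square-mono-< : ∀ {p q} → 0ℚ ≤ p → p < q → p * p < q * q
square-mono-< {p} {q} 0≤p p<q = ℚ.≤-<-trans
  (ℚ.*-monoˡ-≤-nonNeg p {{ℚ.nonNegative 0≤p}} (ℚ.<⇒≤ p<q))
  (ℚ.*-monoˡ-<-pos q {{ℚ.positive (ℚ.≤-<-trans 0≤p p<q)}} p<q)

-- abstract: otherwise with-abstractions over uses of these lemmas normalise their proofs.
abstract
  small : ∀ {b m g} → 0ℚ < b → 0ℚ < m → 0ℚ < g →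
          ∃[ δ ] 0ℚ < δ × δ ≤ b × δ * m < g
  small {b} {m} {g} 0<b 0<m 0<g = b ⊓ k , 0<δ , ℚ.p⊓q≤p b k , δm<g
    where
    instance
      m⁺ : ℚ.Positive m
      m⁺ = ℚ.positive 0<m
      m≢0 : ℚ.NonZero m
      m≢0 = ℚ.pos⇒nonZero m
    h : ℚ
    h = proj₁ (ℚ.<-dense 0<g)
    k : ℚ
    k = h * 1/ m
    0<k : 0ℚ < k
    0<k = ℚ.positive⁻¹ k
      {{ℚ.pos*pos⇒pos h {{ℚ.positive (proj₁ (proj₂ (ℚ.<-dense 0<g)))}} (1/ m) {{ℚ.1/pos⇒pos m}}}}
    0<δ : 0ℚ < b ⊓ k
    0<δ with ℚ.⊓-sel b k
    ... | inj₁ e = subst (0ℚ <_) (sym e) 0<b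
    ... | inj₂ e = subst (0ℚ <_) (sym e) 0<k
    km≡h : k * m ≡ h
    km≡h = trans (ℚ.*-assoc h (1/ m) m) (trans (cong (h *_) (ℚ.*-inverseˡ m)) (ℚ.*-identityʳ h))
    δm<g : (b ⊓ k) * m < g
    δm<g = ℚ.≤-<-trans
      (subst ((b ⊓ k) * m ≤_) km≡h
        (ℚ.*-monoʳ-≤-nonNeg m {{ℚ.pos⇒nonNeg m}} (ℚ.p⊓q≤q b k)))
      (proj₂ (proj₂ (ℚ.<-dense 0<g)))

fromℕ : ℕ → ℚ
fromℕ zero    = 0ℚ
fromℕ (suc k) = 1ℚ + fromℕ k

toℚᵘ-fromℕ : ∀ k → ℚ.toℚᵘ (fromℕ k) ℚᵘ.≃ ℚᵘ.mkℚᵘ (+ k) 0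
toℚᵘ-fromℕ zero    = ℚᵘ.≃-refl
toℚᵘ-fromℕ (suc k) = ℚᵘ.≃-trans (ℚ.toℚᵘ-homo-+ 1ℚ (fromℕ k))
  (ℚᵘ.≃-trans (ℚᵘ.+-congʳ (ℚ.toℚᵘ 1ℚ) (toℚᵘ-fromℕ k))
    (ℚᵘ.*≡* (cong (λ i → (+ 1 ℤ.+ i) ℤ.* + 1) (ℤ.*-identityʳ (+ k)))))

abstract
  archimedean : ∀ p → ∃[ k ] p ≤ fromℕ k
  archimedean p@(ℚ.mkℚ m d-1 _) = ℤ.∣ m ∣ , ℚ.toℚᵘ-cancel-≤
    (ℚᵘ.≤-respʳ-≃ (ℚᵘ.≃-sym (toℚᵘ-fromℕ ℤ.∣ m ∣)) (ℚᵘ.*≤* (bound m)))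
    where
    bound : ∀ m → m ℤ.* + 1 ℤ.≤ + ℤ.∣ m ∣ ℤ.* + suc d-1
    bound (+ m)    = subst₂ ℤ._≤_ (sym (ℤ.*-identityʳ (+ m))) (ℤ.pos-* m (suc d-1))
                       (ℤ.+≤+ (ℕ.m≤m*n m (suc d-1)))
    bound -[1+ m ] = ℤ.-≤+

infix  4 _≤ᴿ_ _≃ᴿ_
infixl 6 _+ᴿ_

-- Dedekind cuts: L q and U q say q < x and x < q for the real number x presented.
record ℝ : Set₁ where
  field
    L U         : ℚ → Set
    L-inhabited : ∃ L
    U-inhabited : ∃ U
    L-lower     : ∀ {p q} → p < q → L q → L p
    U-upper     : ∀ {p q} → p < q → U p → U q
    L-open      : ∀ {p} → L p → ∃[ q ] p < q × L q
    U-open      : ∀ {q} → U q → ∃[ p ] p < q × U p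
    disjoint    : ∀ {q} → L q → U q → ⊥
    located     : ∀ {p q} → p < q → L p ⊎ U q

_≤ᴿ_ : ℝ → ℝ → Set
x ≤ᴿ y = ∀ {q} → ℝ.L x q → ℝ.L y q

-- Equality of real numbers: distinct records may present the same cut.
_≃ᴿ_ : ℝ → ℝ → Set
x ≃ᴿ y = x ≤ᴿ y × y ≤ᴿ x

0ᴿ : ℝ
0ᴿ = record
  { L           = _< 0ℚ
  ; U           = 0ℚ <_
  ; L-inhabited = - 1ℚ , ℚ.negative⁻¹ (- 1ℚ)
  ; U-inhabited = 1ℚ , ℚ.positive⁻¹ 1ℚ
  ; L-lower     = ℚ.<-trans
  ; U-upper     = λ p<q 0<p → ℚ.<-trans 0<p p<q
  ; L-open      = λ p<0 → let r , p<r , r<0 = ℚ.<-dense p<0 in r , p<r , r<0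
  ; U-open      = λ 0<q → let r , 0<r , r<q = ℚ.<-dense 0<q in r , r<q , 0<r
  ; disjoint    = ℚ.<-asym
  ; located     = loc
  }
  where
  loc : ∀ {p q} → p < q → p < 0ℚ ⊎ 0ℚ < q
  loc {p} p<q with p ℚ.<? 0ℚ
  ... | yes p<0 = inj₁ p<0
  ... | no  p≮0 = inj₂ (ℚ.≤-<-trans (ℚ.≮⇒≥ p≮0) p<q)

L<U : ∀ x {p q} → ℝ.L x p → ℝ.U x q → p < q
L<U x {p} {q} Lp Uq with ℚ.<-cmp p q
... | tri< p<q _ _    = p<q
... | tri≈ _ refl _   = ⊥-elim (ℝ.disjoint x Lp Uq)
... | tri> _ _ q<p    = ⊥-elim (ℝ.disjoint x Lp (ℝ.U-upper x q<p Uq))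

abstract
  approximate : ∀ x {ε} → 0ℚ < ε → ∃[ a ] ∃[ c ] ℝ.L x a × ℝ.U x c × c - a < ε
  approximate x {ε} 0<ε =
    let h , 0<h , h<ε = ℚ.<-dense 0<ε
        δ , 0<δ , δ<h = ℚ.<-dense 0<h
        a , La = ℝ.L-inhabited x
        c , Uc = ℝ.U-inhabited x
        k , c≤ = steps 0<δ a c
    in  search 0<δ (ℚ.<-trans δ<h h<ε) k La Uc c≤ h δ<h h<ε
    where
    steps : ∀ {δ} → 0ℚ < δ → ∀ a c → ∃[ k ] c ≤ a + fromℕ k * δ
    steps {δ} 0<δ a c = k , subst (_≤ a + fromℕ k * δ) eq
      (ℚ.+-monoʳ-≤ a (ℚ.*-monoʳ-≤-nonNeg δ {{ℚ.pos⇒nonNeg δ}} (proj₂ (archimedean t))))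
      where
      instance
        δ⁺ : ℚ.Positive δ
        δ⁺ = ℚ.positive 0<δ
        δ≢0 : ℚ.NonZero δ
        δ≢0 = ℚ.pos⇒nonZero δ
      t : ℚ
      t = (c - a) * 1/ δ
      k : ℕ
      k = proj₁ (archimedean t)
      eq : a + t * δ ≡ c
      eq = trans
        (cong (λ z → a + z) (trans (ℚ.*-assoc (c - a) (1/ δ) δ)
          (trans (cong ((c - a) *_) (ℚ.*-inverseˡ δ)) (ℚ.*-identityʳ (c - a)))))
        (solve 2 (λ a c → a :+ (c :- a) := c) refl a c)
        where open +-*-Solver

    search : ∀ {δ} → 0ℚ < δ → δ < ε → ∀ k {a c} → ℝ.L x a → ℝ.U x c →
             c ≤ a + fromℕ k * δ → ∀ h → δ < h → h < ε →
             ∃[ a ] ∃[ c ] ℝ.L x a × ℝ.U x c × c - a < ε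
    search {δ} 0<δ δ<ε zero {a} {c} La Uc c≤ h _ _ = ⊥-elim
      (ℚ.<-irrefl refl (ℚ.<-≤-trans (L<U x La Uc)
        (subst (c ≤_) (trans (cong (λ z → a + z) (ℚ.*-zeroˡ δ)) (ℚ.+-identityʳ a)) c≤)))
    search {δ} 0<δ δ<ε (suc k) {a} {c} La Uc c≤ h δ<h h<ε
      with ℝ.located x (ℚ.+-monoʳ-< a δ<h)
    ... | inj₂ Ua+h = a , a + h , La , Ua+h , subst (_< ε) eq h<ε
      where
      open +-*-Solver
      eq : h ≡ (a + h) - a
      eq = solve 2 (λ a h → h := (a :+ h) :- a) refl a h
    ... | inj₁ La+δ = search 0<δ δ<ε k La+δ Uc (subst (c ≤_) eq c≤) h δ<h h<ε
      where
      eq : a + (1ℚ + fromℕ k) * δ ≡ (a + δ) + fromℕ k * δ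
      eq = trans
        (cong (λ z → a + z) (trans (ℚ.*-distribʳ-+ δ 1ℚ (fromℕ k))
          (cong (_+ fromℕ k * δ) (ℚ.*-identityˡ δ))))
        (sym (ℚ.+-assoc a δ (fromℕ k * δ)))

p+q-q≡p : ∀ p q → (p + q) - q ≡ p
p+q-q≡p = solve 2 (λ p q → (p :+ q) :- q := p) refl
  where open +-*-Solver

p-q+q≡p : ∀ p q → (p - q) + q ≡ p
p-q+q≡p = solve 2 (λ p q → (p :- q) :+ q := p) refl
  where open +-*-Solver

p+[q-p]≡q : ∀ p q → p + (q - p) ≡ q
p+[q-p]≡q = solve 2 (λ p q → p :+ (q :- p) := q) refl
  where open +-*-Solver

transpose-< : ∀ a c p q → c - a < q - p → p - a < q - c
transpose-< a c p q lt = subst₂ _<_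
  (solve 3 (λ a c p → (c :- a) :+ (p :- c) := p :- a) refl a c p)
  (solve 3 (λ c p q → (q :- p) :+ (p :- c) := q :- c) refl c p q)
  (ℚ.+-monoˡ-< (p - c) lt)
  where open +-*-Solver

_+ᴿ_ : ℝ → ℝ → ℝ
x +ᴿ y = record
  { L           = L
  ; U           = U
  ; L-inhabited = let a , La = X.L-inhabited; b , Lb = Y.L-inhabited in a + b , a , b , La , Lb , refl
  ; U-inhabited = let a , Ua = X.U-inhabited; b , Ub = Y.U-inhabited in a + b , a , b , Ua , Ub , refl
  ; L-lower     = L-lower
  ; U-upper     = U-upper
  ; L-open      = L-open
  ; U-open      = U-open
  ; disjoint    = disjoint
  ; located     = located
  }
  where
  module X = ℝ x
  module Y = ℝ y

  L U : ℚ → Set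
  L r = ∃[ a ] ∃[ b ] X.L a × Y.L b × r ≡ a + b
  U r = ∃[ a ] ∃[ b ] X.U a × Y.U b × r ≡ a + b

  L-lower : ∀ {p q} → p < q → L q → L p
  L-lower {p} p<q (a , b , La , Lb , refl) =
    p - b , b , X.L-lower p-b<a La , Lb , sym (p-q+q≡p p b)
    where
    p-b<a : p - b < a
    p-b<a = subst (p - b <_) (p+q-q≡p a b) (ℚ.+-monoˡ-< (- b) p<q)

  U-upper : ∀ {p q} → p < q → U p → U q
  U-upper {_} {q} p<q (a , b , Ua , Ub , refl) =
    q - b , b , X.U-upper a<q-b Ua , Ub , sym (p-q+q≡p q b)
    where
    a<q-b : a < q - b
    a<q-b = subst (_< q - b) (p+q-q≡p a b) (ℚ.+-monoˡ-< (- b) p<q)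

  L-open : ∀ {p} → L p → ∃[ q ] p < q × L q
  L-open (a , b , La , Lb , refl) =
    let a′ , a<a′ , La′ = X.L-open La
    in  a′ + b , ℚ.+-monoˡ-< b a<a′ , a′ , b , La′ , Lb , refl

  U-open : ∀ {q} → U q → ∃[ p ] p < q × U p
  U-open (a , b , Ua , Ub , refl) =
    let a′ , a′<a , Ua′ = X.U-open Ua
    in  a′ + b , ℚ.+-monoˡ-< b a′<a , a′ , b , Ua′ , Ub , refl

  disjoint : ∀ {q} → L q → U q → ⊥
  disjoint (a , b , La , Lb , refl) (c , d , Uc , Ud , eq) =
    ℚ.<-irrefl eq (ℚ.+-mono-< (L<U x La Uc) (L<U y Lb Ud))

  located : ∀ {p q} → p < q → L p ⊎ U q
  located {p} {q} p<q =
    let a , c , La , Uc , c-a<q-p = approximate x (0<q-p p<q)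
    in  map⊎ (λ Lp-a → a , p - a , La , Lp-a , sym (p+[q-p]≡q a p))
             (λ Uq-c → c , q - c , Uc , Uq-c , sym (p+[q-p]≡q c q))
             (Y.located (transpose-< a c p q c-a<q-p))

sumᴿ : List ℝ → ℝ
sumᴿ = foldr _+ᴿ_ 0ᴿ

-- The non-negative square root; √ q is 0 for negative q.
√ : ℚ → ℝ
√ q = record
  { L           = λ r → r < 0ℚ ⊎ r * r < q
  ; U           = λ r → 0ℚ < r × q < r * r
  ; L-inhabited = - 1ℚ , inj₁ (ℚ.negative⁻¹ (- 1ℚ))
  ; U-inhabited = bound , 0<bound , q<bound²
  ; L-lower     = lower
  ; U-upper     = λ { p<r (0<p , q<p²) →
      ℚ.<-trans 0<p p<r , ℚ.<-trans q<p² (square-mono-< (ℚ.<⇒≤ 0<p) p<r) }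
  ; L-open      = L-op
  ; U-open      = U-op
  ; disjoint    = λ { (inj₁ r<0) (0<r , _)    → ℚ.<-asym r<0 0<r
                    ; (inj₂ r²<q) (_ , q<r²)  → ℚ.<-asym r²<q q<r² }
  ; located     = loc
  }
  where
  open +-*-Solver

  k : ℕ
  k = proj₁ (archimedean q)

  bound : ℚ
  bound = 1ℚ + fromℕ k

  0≤fromℕ : ∀ k → 0ℚ ≤ fromℕ k
  0≤fromℕ zero    = ℚ.≤-refl
  0≤fromℕ (suc k) = ℚ.+-mono-≤ (ℚ.<⇒≤ (ℚ.positive⁻¹ 1ℚ)) (0≤fromℕ k)

  1≤bound : 1ℚ ≤ bound
  1≤bound = ℚ.+-monoʳ-≤ 1ℚ (0≤fromℕ k)

  0<bound : 0ℚ < bound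
  0<bound = ℚ.<-≤-trans (ℚ.positive⁻¹ 1ℚ) 1≤bound

  q<bound² : q < bound * bound
  q<bound² = ℚ.≤-<-trans (proj₂ (archimedean q)) (ℚ.<-≤-trans
    (subst (fromℕ k <_) (ℚ.+-comm (fromℕ k) 1ℚ) (p<p+ε (fromℕ k) (ℚ.positive⁻¹ 1ℚ)))
    (subst (_≤ bound * bound) (ℚ.*-identityˡ bound)
      (ℚ.*-monoʳ-≤-nonNeg bound {{ℚ.nonNegative (ℚ.<⇒≤ 0<bound)}} 1≤bound)))

  lower : ∀ {p r} → p < r → r < 0ℚ ⊎ r * r < q → p < 0ℚ ⊎ p * p < q
  lower p<r (inj₁ r<0) = inj₁ (ℚ.<-trans p<r r<0)
  lower {p} p<r (inj₂ r²<q) with p ℚ.<? 0ℚ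
  ... | yes p<0 = inj₁ p<0
  ... | no  p≮0 = inj₂ (ℚ.<-trans (square-mono-< (ℚ.≮⇒≥ p≮0) p<r) r²<q)

  L-op : ∀ {r} → r < 0ℚ ⊎ r * r < q → ∃[ s ] r < s × (s < 0ℚ ⊎ s * s < q)
  L-op (inj₁ r<0) = let s , r<s , s<0 = ℚ.<-dense r<0 in s , r<s , inj₁ s<0
  L-op {r} (inj₂ r²<q) with r ℚ.<? 0ℚ
  ... | yes r<0 = let s , r<s , s<0 = ℚ.<-dense r<0 in s , r<s , inj₁ s<0
  ... | no  r≮0 with small {1ℚ} {r + r + 1ℚ} (ℚ.positive⁻¹ 1ℚ) 0<m (0<q-p r²<q)
    where
    0<m : 0ℚ < r + r + 1ℚ
    0<m = ℚ.+-mono-≤-< (ℚ.+-mono-≤ (ℚ.≮⇒≥ r≮0) (ℚ.≮⇒≥ r≮0)) (ℚ.positive⁻¹ 1ℚ)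
  ...   | δ , 0<δ , δ≤1 , δm<g = r + δ , p<p+ε r 0<δ , inj₂ (subst₂ _<_
    (solve 2 (λ r δ → r :* r :+ δ :* (r :+ r :+ δ) := (r :+ δ) :* (r :+ δ)) refl r δ)
    (solve 2 (λ r q → r :* r :+ (q :- r :* r) := q) refl r q)
    (ℚ.+-monoʳ-< (r * r) (ℚ.≤-<-trans
      (ℚ.*-monoˡ-≤-nonNeg δ {{ℚ.nonNegative (ℚ.<⇒≤ 0<δ)}} (ℚ.+-monoʳ-≤ (r + r) δ≤1)) δm<g)))

  U-op : ∀ {r} → 0ℚ < r × q < r * r → ∃[ s ] s < r × (0ℚ < s × q < s * s)
  U-op {r} (0<r , q<r²) with ℚ.<-dense 0<r
  ... | b , 0<b , b<r with small {b} {r + r} 0<b (ℚ.+-mono-< 0<r 0<r) (0<q-p q<r²)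
  ...   | δ , 0<δ , δ≤b , δm<g = r - δ , p-ε<p r 0<δ , 0<q-p (ℚ.≤-<-trans δ≤b b<r)
    , ℚ.<-≤-trans
        (subst₂ _<_
          (solve 3 (λ r δ q → δ :* (r :+ r) :+ (q :- δ :* (r :+ r)) := q) refl r δ q)
          (solve 3 (λ r δ q → (r :* r :- q) :+ (q :- δ :* (r :+ r)) := r :* r :- δ :* (r :+ r))
            refl r δ q)
          (ℚ.+-monoˡ-< (q - δ * (r + r)) δm<g))
        (subst₂ _≤_ (ℚ.+-identityʳ _)
          (solve 2 (λ r δ → (r :* r :- δ :* (r :+ r)) :+ δ :* δ := (r :- δ) :* (r :- δ)) refl r δ)
          (ℚ.+-monoʳ-≤ (r * r - δ * (r + r)) (0≤p*q (ℚ.<⇒≤ 0<δ) (ℚ.<⇒≤ 0<δ))))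

  loc : ∀ {p r} → p < r → (p < 0ℚ ⊎ p * p < q) ⊎ (0ℚ < r × q < r * r)
  loc {p} {r} p<r with p ℚ.<? 0ℚ | q ℚ.<? r * r
  ... | yes p<0 | _        = inj₁ (inj₁ p<0)
  ... | no  p≮0 | yes q<r² = inj₂ (ℚ.≤-<-trans (ℚ.≮⇒≥ p≮0) p<r , q<r²)
  ... | no  p≮0 | no  q≮r² =
    inj₁ (inj₂ (ℚ.<-≤-trans (square-mono-< (ℚ.≮⇒≥ p≮0) p<r) (ℚ.≮⇒≥ q≮r²)))

-- The order of the graph is n; its vertices are labelled by Fin n.
record Graph (n : ℕ) : Set₁ where
  field
    Adj        : Rel (Fin n) 0ℓ
    adj?       : Decidable Adj
    adj-sym    : Symmetric Adj
    adj-irrefl : Irreflexive _≡_ Adj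

  degree : Fin n → ℕ
  degree u = length (filter (adj? u) (allFin n))

  Pendent : Fin n → Set
  Pendent u = degree u ≡ 1

  Connected : Set
  Connected = ∀ u v → Star Adj u v

  -- Each edge uv is listed once, with u < v.
  IsEdge : Fin n × Fin n → Set
  IsEdge (u , v) = u Fin.< v × Adj u v

  isEdge? : Decidable₁ IsEdge
  isEdge? (u , v) = (u Fin.<? v) ×-dec adj? u v

  edges : List (∃ IsEdge)
  edges = All.toList (all-filter isEdge? (cartesianProduct (allFin n) (allFin n)))

  adj⇒degree>0 : ∀ {u v} → Adj u v → 0 ℕ.< degree u
  adj⇒degree>0 {u} {v} uv = nonempty (∈-filter⁺ (adj? u) (∈-allFin v) uv)
    where
    nonempty : ∀ {xs : List (Fin n)} → v ∈ xs → 0 ℕ.< length xs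
    nonempty (here _)  = ℕ.s≤s ℕ.z≤n
    nonempty (there _) = ℕ.s≤s ℕ.z≤n

open Graph public using (Pendent; Connected)

module _ {n : ℕ} (G : Graph n) where
  open Graph G

  -- The numerator is subtracted in ℤ, where there is no truncation.
  ABC-term ABS-term : ∃ IsEdge → ℝ

  ABC-term ((u , v) , _ , uv) =
    √ ((+ degree u ℤ.+ + degree v ℤ.- + 2) ℚ./ (degree u ℕ.* degree v))
    where
    instance
      product≢0 : ℕ.NonZero (degree u ℕ.* degree v)
      product≢0 = ℕ.m*n≢0 (degree u) (degree v)
        {{ℕ.>-nonZero (adj⇒degree>0 uv)}} {{ℕ.>-nonZero (adj⇒degree>0 (adj-sym uv))}}

  ABS-term ((u , v) , _ , uv) =
    √ ((+ degree u ℤ.+ + degree v ℤ.- + 2) ℚ./ (degree u ℕ.+ degree v))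
    where
    instance
      sum≢0 : ℕ.NonZero (degree u ℕ.+ degree v)
      sum≢0 = ℕ.>-nonZero (ℕ.<-≤-trans (adj⇒degree>0 uv) (ℕ.m≤m+n (degree u) (degree v)))

  ABC ABS : ℝ
  ABC = sumᴿ (map ABC-term edges)
  ABS = sumᴿ (map ABS-term edges)

infix 4 _≅_

_≅_ : ∀ {n} → Graph n → Graph n → Set
_≅_ {n} G H = Σ[ f ∈ Fin n ↔ Fin n ]
  (∀ u v → Graph.Adj G u v ⇔ Graph.Adj H (Inverse.to f u) (Inverse.to f v))

-- Vertex i is joined to i + 1 modulo n. For n ≤ 2 this would not be a cycle in a simple graph.
cycle : ∀ n → 3 ℕ.≤ n → Graph n
cycle n 3≤n = record
  { Adj        = λ i j → Next i j ⊎ Next j i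
  ; adj?       = λ i j → next? i j ⊎-dec next? j i
  ; adj-sym    = swap
  ; adj-irrefl = λ { {i} refl (inj₁ e) → irrefl i e ; {i} refl (inj₂ e) → irrefl i e }
  }
  where
  instance
    n≢0 : ℕ.NonZero n
    n≢0 = ℕ.>-nonZero (ℕ.≤-trans (ℕ.s≤s ℕ.z≤n) 3≤n)

  Next : Rel (Fin n) 0ℓ
  Next i j = toℕ j ≡ suc (toℕ i) ℕ.% n

  next? : Decidable Next
  next? i j = toℕ j ℕ.≟ suc (toℕ i) ℕ.% n

  irrefl : ∀ i → ¬ Next i i
  irrefl i e with ℕ.m≤n⇒m<n∨m≡n (Fin.toℕ<n i)
  ... | inj₁ 1+i<n = ℕ.1+n≢n (sym (trans e (ℕ.m<n⇒m%n≡m 1+i<n)))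
  ... | inj₂ 1+i≡n = contradiction (subst (3 ℕ.≤_) n≡1 3≤n) λ { (ℕ.s≤s ()) }
    where
    i≡0 : toℕ i ≡ 0
    i≡0 = trans e (trans (cong (ℕ._% n) 1+i≡n) (ℕ.n%n≡0 n))
    n≡1 : n ≡ 1
    n≡1 = trans (sym 1+i≡n) (cong suc i≡0)

{-# OPTIONS --safe #-}

-- All degrees are at least 2, so d_u + d_v ≤ d_u d_v on every edge, with equality only
-- for d_u = d_v = 2; comparing the sums term by term gives the inequality, and equality
-- forces the graph to be 2-regular. To recognise a connected 2-regular graph as a cycle,
-- follow a walk that never turns back: its first repeated vertex is its starting point, and
-- the closed path so obtained contains all neighbours of its vertices, hence all vertices.

module Submission where

open import Defs
open import Data.Nat using (ℕ; _≤_)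
open import Data.Product using (_×_; Σ-syntax)
open import Function.Bundles using (_⇔_)
open import Relation.Nullary using (¬_)

open import Data.Nat as ℕ using (zero; suc; _<_; s≤s; z≤n; s<s; z<s)
import Data.Nat.Properties as ℕ
import Data.Nat.DivMod as ℕ
open import Data.Integer as ℤ using (+_)
import Data.Integer.Properties as ℤ
open import Data.Rational as ℚ using (ℚ; 0ℚ; 1ℚ)
import Data.Rational.Properties as ℚ
import Data.Rational.Unnormalised as ℚᵘ
import Data.Rational.Unnormalised.Properties as ℚᵘ
open import Data.Rational.Solver using (module +-*-Solver)
open import Data.Fin as Fin using (Fin; toℕ; fromℕ<)
import Data.Fin.Properties as Fin
open import Data.List using (List; []; _∷_; map; length; filter; allFin; cartesianProduct)
open import Data.List.Membership.Propositional using (_∈_)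
open import Data.List.Membership.Propositional.Properties
  using (∈-filter⁺; ∈-filter⁻; ∈-allFin; ∈-cartesianProduct⁺)
open import Data.List.Relation.Unary.Any using (here; there)
open import Data.List.Relation.Unary.All as All using (All; []; _∷_)
open import Data.List.Relation.Unary.All.Properties using (all-filter)
open import Data.List.Relation.Unary.AllPairs using ([]; _∷_)
open import Data.List.Relation.Unary.Unique.Propositional using (Unique)
import Data.List.Relation.Unary.Unique.Propositional.Properties as Unique
open import Data.Product using (∃; ∃-syntax; _,_; proj₁; proj₂)
open import Data.Sum as Sum using (_⊎_; inj₁; inj₂)
open import Data.Empty using (⊥-elim)
open import Function using (_∘_)
open import Function.Bundles using (mk⇔; mk↔ₛ′; Inverse; Equivalence)
open import Relation.Nullary using (yes; no; contradiction)
open import Relation.Binary using (tri<; tri≈; tri>)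
open import Relation.Binary.Construct.Closure.ReflexiveTransitive using (Star; ε; _◅_)
open import Relation.Binary.PropositionalEquality

-- Strict order of real numbers and monotonicity of sums.

infix 4 _<ᴿ_

-- Strictness is carried by a separating rational, a witness that can be transported through sums
-- and that `disjoint` turns into a refutation of `y ≤ᴿ x`.
_<ᴿ_ : ℝ → ℝ → Set
x <ᴿ y = ∃[ q ] ℝ.U x q × ℝ.L y q

<ᴿ⇒≱ᴿ : ∀ x y → x <ᴿ y → ¬ (y ≤ᴿ x)
<ᴿ⇒≱ᴿ x y (q , Uq , Lq) y≤x = ℝ.disjoint x (y≤x Lq) Uq

+ᴿ-mono-≤ : ∀ x y z w → x ≤ᴿ y → z ≤ᴿ w → x +ᴿ z ≤ᴿ y +ᴿ w
+ᴿ-mono-≤ x y z w x≤y z≤w (a , b , La , Lb , eq) = a , b , x≤y La , z≤w Lb , eq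

-- Openness of the lower cut of `y` gives room `r - q` above the separating `q`. Enclosing `z`
-- between `a` and `c` closer than this room yields `q + c < r + a`, and `r + a` separates the sums.
+ᴿ-mono-<-≤ : ∀ x y z w → x <ᴿ y → z ≤ᴿ w → x +ᴿ z <ᴿ y +ᴿ w
+ᴿ-mono-<-≤ x y z w (q , Uq , Lq) z≤w =
  let r , q<r , Lr          = ℝ.L-open y Lq
      a , c , La , Uc , c-a = approximate z (0<q-p q<r)
  in  r ℚ.+ a
    , ℝ.U-upper (x +ᴿ z) (q+c<r+a a c q r c-a) (q , c , Uq , Uc , refl)
    , r , a , Lr , z≤w La , refl
  where
  open +-*-Solver
  q+c<r+a : ∀ a c q r → c ℚ.- a ℚ.< r ℚ.- q → q ℚ.+ c ℚ.< r ℚ.+ a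
  q+c<r+a a c q r lt = subst₂ ℚ._<_
    (solve 3 (λ a c q → (c :- a) :+ (q :+ a) := q :+ c) refl a c q)
    (solve 3 (λ a q r → (r :- q) :+ (q :+ a) := r :+ a) refl a q r)
    (ℚ.+-monoˡ-< (q ℚ.+ a) lt)

+ᴿ-mono-≤-< : ∀ x y z w → x ≤ᴿ y → z <ᴿ w → x +ᴿ z <ᴿ y +ᴿ w
+ᴿ-mono-≤-< x y z w x≤y z<w =
  let q , (a , b , Ua , Ub , eq) , (c , d , Lc , Ld , eq′) = +ᴿ-mono-<-≤ z w x y z<w x≤y
  in  q , (b , a , Ub , Ua , trans eq (ℚ.+-comm a b)) , (d , c , Ld , Lc , trans eq′ (ℚ.+-comm c d))

module _ {A : Set} {f g : A → ℝ} (f≤g : ∀ a → f a ≤ᴿ g a) where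

  sumᴿ-mono-≤ : ∀ xs → sumᴿ (map f xs) ≤ᴿ sumᴿ (map g xs)
  sumᴿ-mono-≤ []       L0 = L0
  sumᴿ-mono-≤ (x ∷ xs) =
    +ᴿ-mono-≤ (f x) (g x) (sumᴿ (map f xs)) (sumᴿ (map g xs)) (f≤g x) (sumᴿ-mono-≤ xs)

  sumᴿ-mono-< : ∀ {a xs} → a ∈ xs → f a <ᴿ g a → sumᴿ (map f xs) <ᴿ sumᴿ (map g xs)
  sumᴿ-mono-< {xs = x ∷ xs} (here refl) fa<ga =
    +ᴿ-mono-<-≤ (f x) (g x) (sumᴿ (map f xs)) (sumᴿ (map g xs)) fa<ga (sumᴿ-mono-≤ xs)
  sumᴿ-mono-< {xs = x ∷ xs} (there a∈xs) fa<ga =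
    +ᴿ-mono-≤-< (f x) (g x) (sumᴿ (map f xs)) (sumᴿ (map g xs)) (f≤g x) (sumᴿ-mono-< a∈xs fa<ga)

-- Monotonicity of the square root.

√-mono-≤ : ∀ {p q} → p ℚ.≤ q → √ p ≤ᴿ √ q
√-mono-≤ p≤q (inj₁ r<0)  = inj₁ r<0
√-mono-≤ p≤q (inj₂ r²<p) = inj₂ (ℚ.<-≤-trans r²<p p≤q)

-- If a < √ q < c with c - a small, then a² exceeds p, because
-- q - a² < c² - a² = (c - a)(c + a).
√<lower : ∀ {p q b δ a c} → 0ℚ ℚ.≤ p → ℝ.U (√ q) b →
          0ℚ ℚ.< δ → δ ℚ.≤ 1ℚ → δ ℚ.* (b ℚ.+ (b ℚ.+ 1ℚ)) ℚ.< q ℚ.- p →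
          ℝ.L (√ q) a → ℝ.U (√ q) c → c ℚ.- a ℚ.< δ → ℝ.U (√ p) a
√<lower {p} {q} {b} {δ} {a} {c} 0≤p Ub@(0<b , _) 0<δ δ≤1 δm<q-p La (0<c , q<c²) c-a<δ =
  0<a , p<a²
  where
  open +-*-Solver
  open ℚ.≤-Reasoning

  c<a+δ : c ℚ.< a ℚ.+ δ
  c<a+δ = subst₂ ℚ._<_ (p-q+q≡p c a) (ℚ.+-comm δ a) (ℚ.+-monoˡ-< a c-a<δ)

  a<b : a ℚ.< b
  a<b = L<U (√ q) La Ub

  c≤b+1 : c ℚ.≤ b ℚ.+ 1ℚ
  c≤b+1 = ℚ.<⇒≤ (ℚ.<-≤-trans c<a+δ (ℚ.+-mono-≤ (ℚ.<⇒≤ a<b) δ≤1))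

  product<q-p : ∀ {s t} → 0ℚ ℚ.≤ s → s ℚ.≤ b ℚ.+ (b ℚ.+ 1ℚ) → t ℚ.≤ δ → t ℚ.* s ℚ.< q ℚ.- p
  product<q-p {s} {t} 0≤s s≤m t≤δ = begin-strict
    t ℚ.* s                     ≤⟨ ℚ.*-monoʳ-≤-nonNeg s {{ℚ.nonNegative 0≤s}} t≤δ ⟩
    δ ℚ.* s                     ≤⟨ ℚ.*-monoˡ-≤-nonNeg δ {{ℚ.nonNegative (ℚ.<⇒≤ 0<δ)}} s≤m ⟩
    δ ℚ.* (b ℚ.+ (b ℚ.+ 1ℚ))    <⟨ δm<q-p ⟩
    q ℚ.- p                     ∎

  0<a : 0ℚ ℚ.< a
  0<a with 0ℚ ℚ.<? a
  ... | yes 0<a = 0<a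
  -- If `a ≤ 0` then `c ≤ δ`, so `q < c² < q - p ≤ q`, the last step by `0 ≤ p`.
  ... | no  0≮a = ⊥-elim (ℚ.<-irrefl refl (begin-strict
    q          <⟨ q<c² ⟩
    c ℚ.* c    <⟨ product<q-p (ℚ.<⇒≤ 0<c) c≤m c≤δ ⟩
    q ℚ.- p    ≤⟨ ℚ.+-monoʳ-≤ q (ℚ.neg-antimono-≤ 0≤p) ⟩
    q ℚ.+ 0ℚ   ≡⟨ ℚ.+-identityʳ q ⟩
    q          ∎))
    where
    c≤δ : c ℚ.≤ δ
    c≤δ = ℚ.<⇒≤ (ℚ.<-≤-trans c<a+δ (subst (a ℚ.+ δ ℚ.≤_) (ℚ.+-identityˡ δ)
            (ℚ.+-monoˡ-≤ δ (ℚ.≮⇒≥ 0≮a))))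
    c≤m : c ℚ.≤ b ℚ.+ (b ℚ.+ 1ℚ)
    c≤m = subst (ℚ._≤ b ℚ.+ (b ℚ.+ 1ℚ)) (ℚ.+-identityˡ c) (ℚ.+-mono-≤ (ℚ.<⇒≤ 0<b) c≤b+1)

  p<a² : p ℚ.< a ℚ.* a
  p<a² = subst₂ ℚ._<_
    (solve 2 (λ p q → q :- (q :- p) := p) refl p q)
    (solve 2 (λ a c → c :* c :- (c :- a) :* (a :+ c) := a :* a) refl a c)
    (ℚ.+-mono-< q<c² (ℚ.neg-antimono-<
      (product<q-p (ℚ.<⇒≤ (ℚ.+-mono-< 0<a 0<c)) (ℚ.+-mono-≤ (ℚ.<⇒≤ a<b) c≤b+1) (ℚ.<⇒≤ c-a<δ))))

√-mono-< : ∀ {p q} → 0ℚ ℚ.≤ p → p ℚ.< q → √ p <ᴿ √ q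
√-mono-< {p} {q} 0≤p p<q =
  let b , Ub                  = ℝ.U-inhabited (√ q)
      0<b , _                 = Ub
      -- The factor `b + (b + 1)` bounds `a + c`: `a < b`, and `c < a + δ ≤ b + 1` because `δ ≤ 1`.
      δ , 0<δ , δ≤1 , δm<q-p  = small {1ℚ} {b ℚ.+ (b ℚ.+ 1ℚ)} {q ℚ.- p} (ℚ.positive⁻¹ 1ℚ)
        (ℚ.+-mono-< 0<b (ℚ.+-mono-< 0<b (ℚ.positive⁻¹ 1ℚ))) (0<q-p p<q)
      a , c , La , Uc , c-a<δ = approximate (√ q) 0<δ
  in  a , √<lower 0≤p Ub 0<δ δ≤1 δm<q-p La Uc c-a<δ , La

-- Fractions with a fixed numerator.

/-antimono-≤ : ∀ i .{{_ : ℤ.NonNegative i}} {m n} .{{_ : ℕ.NonZero m}} .{{_ : ℕ.NonZero n}} →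
               m ℕ.≤ n → i ℚ./ n ℚ.≤ i ℚ./ m
/-antimono-≤ i {suc m} {suc n} m≤n = ℚ.toℚᵘ-cancel-≤
  (ℚᵘ.≤-respˡ-≃ (ℚᵘ.≃-sym (ℚ.toℚᵘ-fromℚᵘ (ℚᵘ.mkℚᵘ i n)))
    (ℚᵘ.≤-respʳ-≃ (ℚᵘ.≃-sym (ℚ.toℚᵘ-fromℚᵘ (ℚᵘ.mkℚᵘ i m)))
      (ℚᵘ.*≤* (ℤ.*-monoˡ-≤-nonNeg i (ℤ.+≤+ m≤n)))))

/-antimono-< : ∀ i .{{_ : ℤ.Positive i}} {m n} .{{_ : ℕ.NonZero m}} .{{_ : ℕ.NonZero n}} →
               m ℕ.< n → i ℚ./ n ℚ.< i ℚ./ m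
/-antimono-< i {suc m} {suc n} m<n = ℚ.toℚᵘ-cancel-<
  (ℚᵘ.<-respˡ-≃ (ℚᵘ.≃-sym (ℚ.toℚᵘ-fromℚᵘ (ℚᵘ.mkℚᵘ i n)))
    (ℚᵘ.<-respʳ-≃ (ℚᵘ.≃-sym (ℚ.toℚᵘ-fromℚᵘ (ℚᵘ.mkℚᵘ i m)))
      (ℚᵘ.*<* (ℤ.*-monoˡ-<-pos i (ℤ.+<+ m<n)))))

0≤/ : ∀ i .{{_ : ℤ.NonNegative i}} n .{{_ : ℕ.NonZero n}} → 0ℚ ℚ.≤ i ℚ./ n
0≤/ (+ k) n = ℚ.nonNegative⁻¹ (+ k ℚ./ n) {{ℚ.normalize-nonNeg k n}}

-- Lists of length two and vertices of degree two.

length≡2⁺ : ∀ {A : Set} {xs : List A} {a b} → Unique xs → a ≢ b → a ∈ xs → b ∈ xs →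
            (∀ {x} → x ∈ xs → x ≡ a ⊎ x ≡ b) → length xs ≡ 2
length≡2⁺ {xs = _ ∷ []} _ a≢b (here refl) (here refl) _ = contradiction refl a≢b
length≡2⁺ {xs = _ ∷ _ ∷ []} _ _ _ _ _ = refl
-- Three entries share two possible values, so two of them coincide, against uniqueness.
length≡2⁺ {xs = x ∷ y ∷ z ∷ xs} ((x≢y ∷ x≢z ∷ _) ∷ (y≢z ∷ _) ∷ _) _ _ _ only
  with only (here refl) | only (there (here refl)) | only (there (there (here refl)))
... | inj₁ refl | inj₁ refl | _         = contradiction refl x≢y
... | inj₁ refl | inj₂ refl | inj₁ refl = contradiction refl x≢z
... | inj₁ refl | inj₂ refl | inj₂ refl = contradiction refl y≢z
... | inj₂ refl | inj₂ refl | _         = contradiction refl x≢y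
... | inj₂ refl | inj₁ refl | inj₁ refl = contradiction refl y≢z
... | inj₂ refl | inj₁ refl | inj₂ refl = contradiction refl x≢z

length≡2⁻ : ∀ {A : Set} {xs : List A} {a} → Unique xs → length xs ≡ 2 → a ∈ xs →
            ∃[ b ] b ∈ xs × b ≢ a × (∀ {x} → x ∈ xs → x ≡ a ⊎ x ≡ b)
length≡2⁻ {xs = x ∷ y ∷ []} ((x≢y ∷ []) ∷ _) _ (here refl) =
  y , there (here refl) , x≢y ∘ sym ,
  λ { (here refl) → inj₁ refl ; (there (here refl)) → inj₂ refl }
length≡2⁻ {xs = x ∷ y ∷ []} ((x≢y ∷ []) ∷ _) _ (there (here refl)) =
  x , here refl , x≢y ,
  λ { (here refl) → inj₂ refl ; (there (here refl)) → inj₁ refl }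

module _ {n : ℕ} (G : Graph n) where
  open Graph G hiding (Connected; Pendent)

  neighbours-unique : ∀ u → Unique (filter (adj? u) (allFin n))
  neighbours-unique u = Unique.filter⁺ (adj? u) (Unique.allFin⁺ n)

  ∈-neighbours⁺ : ∀ {u v} → Adj u v → v ∈ filter (adj? u) (allFin n)
  ∈-neighbours⁺ {u} {v} = ∈-filter⁺ (adj? u) (∈-allFin v)

  ∈-neighbours⁻ : ∀ {u v} → v ∈ filter (adj? u) (allFin n) → Adj u v
  ∈-neighbours⁻ {u} = proj₂ ∘ ∈-filter⁻ (adj? u) {xs = allFin n}

  degree≡2⁺ : ∀ {u a b} → a ≢ b → Adj u a → Adj u b →
              (∀ {v} → Adj u v → v ≡ a ⊎ v ≡ b) → degree u ≡ 2
  degree≡2⁺ {u} a≢b ua ub only = length≡2⁺ (neighbours-unique u) a≢b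
    (∈-neighbours⁺ ua) (∈-neighbours⁺ ub) (only ∘ ∈-neighbours⁻)

  -- For a walk that reaches `u` from `a`, the vertex `b` is the only way on without turning back.
  degree≡2⁻ : ∀ {u a} → degree u ≡ 2 → Adj u a →
              ∃[ b ] Adj u b × b ≢ a × (∀ {v} → Adj u v → v ≡ a ⊎ v ≡ b)
  degree≡2⁻ {u} du≡2 ua =
    let b , b∈ , b≢a , only = length≡2⁻ (neighbours-unique u) du≡2 (∈-neighbours⁺ ua)
    in  b , ∈-neighbours⁻ b∈ , b≢a , only ∘ ∈-neighbours⁺

  degree>0⇒adj : ∀ {u} → 0 < degree u → ∃ (Adj u)
  degree>0⇒adj {u} 0<d = nonempty (λ v∈ → ∈-neighbours⁻ v∈) 0<d
    where
    nonempty : ∀ {xs : List (Fin n)} → (∀ {v} → v ∈ xs → Adj u v) → 0 < length xs → ∃ (Adj u)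
    nonempty {v ∷ _} adj _ = v , adj (here refl)

-- Walks that never turn back, and their first repetition.

suc-%-cases : ∀ {i n} .{{_ : ℕ.NonZero n}} → i < n →
              (suc i < n × suc i ℕ.% n ≡ suc i) ⊎ (suc i ≡ n × suc i ℕ.% n ≡ 0)
suc-%-cases {i} {n} i<n with ℕ.m≤n⇒m<n∨m≡n i<n
... | inj₁ 1+i<n = inj₁ (1+i<n , ℕ.m<n⇒m%n≡m 1+i<n)
... | inj₂ refl  = inj₂ (refl , ℕ.n%n≡0 n)

-- An infinite walk without backtracking, each of whose vertices has only its two companions on the
-- walk as neighbours. `exhaustive` starts at `w 1`, since `w 0` has no predecessor; the neighbours
-- of `w 0` are found once the walk is known to close.
record Tour {n} (G : Graph n) : Set where
  open Graph G hiding (Connected; Pendent)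
  field
    w          : ℕ → Fin n
    edge       : ∀ k → Adj (w k) (w (suc k))
    no-return  : ∀ k → w (suc (suc k)) ≢ w k
    exhaustive : ∀ k {v} → Adj (w (suc k)) v → v ≡ w k ⊎ v ≡ w (suc (suc k))

module _ {n : ℕ} (G : Graph n) where
  open Graph G hiding (Connected; Pendent)

  2-regular⇒tour : (∀ u → degree u ≡ 2) → Fin n → Tour G
  2-regular⇒tour regular u₀ = record
    { w          = λ k → proj₁ (dart k)
    ; edge       = λ k → proj₂ (proj₂ (dart k))
    ; no-return  = λ k → proj₁ (proj₂ (proj₂ (other (dart k))))
    ; exhaustive = λ k → proj₂ (proj₂ (proj₂ (other (dart k))))
    }
    where
    -- The next vertex depends on the last two, so the recursion runs over directed edges.
    Dart : Set
    Dart = ∃[ u ] ∃[ v ] Adj u v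

    other : ((u , v , _) : Dart) →
            ∃[ b ] Adj v b × b ≢ u × (∀ {x} → Adj v x → x ≡ u ⊎ x ≡ b)
    other (u , v , uv) = degree≡2⁻ G (regular v) (adj-sym uv)

    dart : ℕ → Dart
    dart zero    = u₀ , degree>0⇒adj G (subst (0 <_) (sym (regular u₀)) z<s)
    dart (suc k) = let _ , v , _ = dart k; b , vb , _ = other (dart k) in v , b , vb

  module _ (tour : Tour G) where
    open Tour tour

    InjectiveBelow : ℕ → Set
    InjectiveBelow m = ∀ {i j} → i < m → j < m → w i ≡ w j → i ≡ j

    FirstRepetition : ℕ → Set
    FirstRepetition m = InjectiveBelow m × ∃[ i ] i < m × w i ≡ w m

    injectiveBelow-suc : ∀ {m} → InjectiveBelow m → ¬ (∃[ i ] i < m × w i ≡ w m) →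
                         InjectiveBelow (suc m)
    injectiveBelow-suc inj new i<1+m j<1+m e
      with ℕ.m<1+n⇒m<n∨m≡n i<1+m | ℕ.m<1+n⇒m<n∨m≡n j<1+m
    ... | inj₁ i<m  | inj₁ j<m  = inj i<m j<m e
    ... | inj₁ i<m  | inj₂ refl = contradiction (_ , i<m , e) new
    ... | inj₂ refl | inj₁ j<m  = contradiction (_ , j<m , sym e) new
    ... | inj₂ refl | inj₂ refl = refl

    injectiveBelow⊎repetition : ∀ m → InjectiveBelow m ⊎ ∃ FirstRepetition
    injectiveBelow⊎repetition zero = inj₁ λ ()
    injectiveBelow⊎repetition (suc m) with injectiveBelow⊎repetition m
    ... | inj₂ rep = inj₂ rep
    ... | inj₁ inj with ℕ.anyUpTo? (λ i → w i Fin.≟ w m) m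
    ...   | yes old = inj₂ (m , inj , old)
    ...   | no  new = inj₁ (injectiveBelow-suc inj new)

    injectiveBelow⇒≤ : ∀ {m} → InjectiveBelow m → m ≤ n
    injectiveBelow⇒≤ inj = Fin.injective⇒≤ {f = w ∘ toℕ}
      (λ e → Fin.toℕ-injective (inj (Fin.toℕ<n _) (Fin.toℕ<n _) e))

    firstRepetition : ∃ FirstRepetition
    firstRepetition with injectiveBelow⊎repetition (suc n)
    -- The first `suc n` vertices cannot be distinct in `Fin n`, so the search below `suc n` meets a
    -- repetition.
    ... | inj₁ inj = contradiction (injectiveBelow⇒≤ inj) ℕ.1+n≰n
    ... | inj₂ rep = rep

    -- Were w m = w i with i > 0, the vertex w (m - 1) would be a neighbour of w i,
    -- hence w (i - 1) or w (i + 1), against injectivity or the absence of backtracking.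
    repetition-at-0 : ∀ {m} → InjectiveBelow m → ∀ {i} → i < m → w i ≡ w m → i ≡ 0
    repetition-at-0 inj {zero} _ _ = refl
    repetition-at-0 {suc m} inj {suc i} 1+i<1+m e
      with exhaustive i (subst (λ u → Adj u (w m)) (sym e) (adj-sym (edge m)))
    ... | inj₁ wm≡wi = contradiction
      (inj (ℕ.n<1+n m) (ℕ.<-trans (ℕ.n<1+n i) 1+i<1+m) wm≡wi)
      (ℕ.<⇒≢ (ℕ.s<s⁻¹ 1+i<1+m) ∘ sym)
    -- Either `2 + i` is the repetition index `suc m` itself, and an edge becomes a loop, or
    -- injectivity gives `m = 2 + i`, and the walk turns back at `m`.
    ... | inj₂ wm≡w2+i with ℕ.m≤n⇒m<n∨m≡n 1+i<1+m
    ...   | inj₂ refl = ⊥-elim (adj-irrefl e (edge (suc i)))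
    ...   | inj₁ 2+i<1+m with inj (ℕ.n<1+n m) 2+i<1+m wm≡w2+i
    ...     | refl = ⊥-elim (no-return (suc i) (sym e))

    -- Closing after one step would be a loop, after two steps a reversal.
    closed⇒2< : ∀ m .{{_ : ℕ.NonZero m}} → w m ≡ w 0 → 2 < m
    closed⇒2< 1                   e = ⊥-elim (adj-irrefl (sym e) (edge 0))
    closed⇒2< 2                   e = ⊥-elim (no-return 0 e)
    closed⇒2< (suc (suc (suc _))) _ = s≤s (s≤s (s≤s z≤n))

    -- A closed tour in a connected graph is the cycle.

    module _ (connected : Connected G) (m : ℕ) .{{_ : ℕ.NonZero m}} (inj : InjectiveBelow m)
             (closed : w m ≡ w 0) where

      2<m : 2 < m
      2<m = closed⇒2< m closed

      w-suc-% : ∀ {i} → i < m → w (suc i ℕ.% m) ≡ w (suc i)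
      w-suc-% i<m with suc-%-cases i<m
      ... | inj₁ (_ , e)    = cong w e
      ... | inj₂ (refl , e) = trans (cong w e) (sym closed)

      Consecutive : ℕ → ℕ → Set
      Consecutive i j = j ≡ suc i ℕ.% m ⊎ i ≡ suc j ℕ.% m

      adj⇒consecutive : ∀ {i v} → i < m → Adj (w i) v → ∃[ j ] j < m × w j ≡ v × Consecutive i j
      adj⇒consecutive {suc i} 1+i<m a with exhaustive i a
      ... | inj₁ refl = i , ℕ.<-trans (ℕ.n<1+n i) 1+i<m , refl , inj₂ (sym (ℕ.m<n⇒m%n≡m 1+i<m))
      ... | inj₂ refl = suc (suc i) ℕ.% m , ℕ.m%n<n (suc (suc i)) m , w-suc-% 1+i<m , inj₁ refl
      -- The neighbours of `w 0 = w m` are `w (m - 1)` and `w (m + 1)`. To identify the latter with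
      -- `w 1`, note that `w 1` is also such a neighbour, and that it differs from `w (m - 1)` by
      -- injectivity, as `1 < m - 1`.
      adj⇒consecutive {zero} {v} 0<m a = from-w0 m refl
        where
        from-w0 : ∀ k → k ≡ m → ∃[ j ] j < m × w j ≡ v × Consecutive zero j
        from-w0 zero    e = contradiction 0<m (subst (λ l → ¬ (0 < l)) e λ ())
        from-w0 (suc k) refl with exhaustive k (subst (λ u → Adj u v) (sym closed) a)
                                | exhaustive k (subst (λ u → Adj u (w 1)) (sym closed) (edge 0))
        ... | inj₁ refl | _        = k , ℕ.n<1+n k , refl , inj₂ (sym (ℕ.n%n≡0 m))
        ... | inj₂ refl | inj₂ e   = 1 , ℕ.<-trans (ℕ.n<1+n 1) 2<m , e
                                   , inj₁ (sym (ℕ.m<n⇒m%n≡m (ℕ.<-trans (ℕ.n<1+n 1) 2<m)))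
        ... | inj₂ refl | inj₁ e   = contradiction
          (inj (ℕ.<-trans (ℕ.n<1+n 1) 2<m) (ℕ.n<1+n k) e) (ℕ.<⇒≢ (ℕ.s<s⁻¹ 2<m))

      consecutive⇒adj : ∀ {i j} → i < m → j < m → Consecutive i j → Adj (w i) (w j)
      consecutive⇒adj {i} i<m _ (inj₁ refl) = subst (Adj (w i)) (sym (w-suc-% i<m)) (edge i)
      consecutive⇒adj {j = j} _ j<m (inj₂ refl) =
        adj-sym (subst (Adj (w j)) (sym (w-suc-% j<m)) (edge j))

      -- Connectedness gives a path from `w 0` to `v`; by `adj⇒consecutive` no step of it leaves the
      -- closed walk.
      visits : ∀ v → ∃[ j ] j < m × w j ≡ v
      visits v = follow (ℕ.<-trans z<s 2<m) (connected (w 0) v)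
        where
        follow : ∀ {i} → i < m → Star Adj (w i) v → ∃[ j ] j < m × w j ≡ v
        follow i<m ε = _ , i<m , refl
        follow i<m (a ◅ as) with adj⇒consecutive i<m a
        ... | j , j<m , refl , _ = follow j<m as

      index : Fin n → ℕ
      index v = proj₁ (visits v)

      index<m : ∀ v → index v < m
      index<m v = proj₁ (proj₂ (visits v))

      w-index : ∀ v → w (index v) ≡ v
      w-index v = proj₂ (proj₂ (visits v))

      -- Both inequalities come from injections: `w` on the indices below `m`, and `index` on the
      -- vertices.
      m≡n : m ≡ n
      m≡n = ℕ.≤-antisym (injectiveBelow⇒≤ inj)
        (Fin.injective⇒≤ {f = λ v → fromℕ< (index<m v)} λ {u} {v} e →
          trans (sym (w-index u)) (trans
            (cong w (Fin.fromℕ<-injective _ _ (index<m u) (index<m v) e)) (w-index v)))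

      adj⇔consecutive : ∀ u v → Adj u v ⇔ Consecutive (index u) (index v)
      adj⇔consecutive u v = mk⇔ to from
        where
        to : Adj u v → Consecutive (index u) (index v)
        to uv with adj⇒consecutive (index<m u) (subst (λ x → Adj x v) (sym (w-index u)) uv)
        ... | j , j<m , wj≡v , c =
          subst (Consecutive (index u)) (inj j<m (index<m v) (trans wj≡v (sym (w-index v)))) c
        from : Consecutive (index u) (index v) → Adj u v
        from c = subst₂ Adj (w-index u) (w-index v) (consecutive⇒adj (index<m u) (index<m v) c)

  -- The isomorphism sends a vertex to its index. With length `n` in place of `m`, `Consecutive` is
  -- literally the adjacency of `cycle n`.
  closed-tour⇒≅cycle : (tour : Tour G) → Connected G → .{{_ : ℕ.NonZero n}} →
    InjectiveBelow tour n → Tour.w tour n ≡ Tour.w tour 0 → (3≤n : 3 ≤ n) → G ≅ cycle n 3≤n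
  closed-tour⇒≅cycle tour connected inj closed 3≤n =
      mk↔ₛ′ to (w ∘ toℕ) to-w (λ v → trans (cong w (Fin.toℕ-fromℕ< (ix<n v))) (w-index′ v))
    , λ u v → subst₂ (λ i j → Adj u v ⇔ Consecutive tour connected n inj closed i j)
        (sym (Fin.toℕ-fromℕ< (ix<n u))) (sym (Fin.toℕ-fromℕ< (ix<n v)))
        (adj⇔consecutive tour connected n inj closed u v)
    where
    open Tour tour
    ix : Fin n → ℕ
    ix = index tour connected n inj closed
    ix<n : ∀ v → ix v < n
    ix<n = index<m tour connected n inj closed
    w-index′ : ∀ v → w (ix v) ≡ v
    w-index′ = w-index tour connected n inj closed
    to : Fin n → Fin n
    to v = fromℕ< (ix<n v)
    to-w : ∀ i → to (w (toℕ i)) ≡ i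
    to-w i = Fin.toℕ-injective (trans (Fin.toℕ-fromℕ< (ix<n (w (toℕ i))))
      (inj (ix<n _) (Fin.toℕ<n i) (w-index′ _)))

  tour⇒≅cycle : Tour G → Connected G → Σ[ 3≤n ∈ 3 ≤ n ] G ≅ cycle n 3≤n
  tour⇒≅cycle tour connected with firstRepetition tour
  ... | suc m , inj , i , i<m , e with repetition-at-0 tour inj i<m e
  ...   | refl with m≡n tour connected (suc m) inj (sym e)
  ...     | refl = 3≤n , closed-tour⇒≅cycle tour connected inj (sym e) 3≤n
    where
    3≤n : 3 ≤ n
    3≤n = closed⇒2< tour (suc m) (sym e)

-- Two-regularity of the cycle and its transfer along isomorphisms.

suc-%-injective : ∀ {i j n} .{{_ : ℕ.NonZero n}} → i < n → j < n →
                  suc i ℕ.% n ≡ suc j ℕ.% n → i ≡ j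
suc-%-injective i<n j<n e with suc-%-cases i<n | suc-%-cases j<n
... | inj₁ (_ , ei) | inj₁ (_ , ej) = ℕ.suc-injective (trans (sym ei) (trans e ej))
... | inj₁ (_ , ei) | inj₂ (_ , ej) = contradiction (trans (sym ei) (trans e ej)) λ ()
... | inj₂ (_ , ei) | inj₁ (_ , ej) = contradiction (trans (sym ei) (trans e ej)) λ ()
... | inj₂ (ei , _) | inj₂ (ej , _) = ℕ.suc-injective (trans ei (sym ej))

suc-%-surjective : ∀ {i n} .{{_ : ℕ.NonZero n}} → i < n → ∃[ j ] j < n × i ≡ suc j ℕ.% n
suc-%-surjective {zero}  {suc n} _     = n , ℕ.n<1+n n , sym (ℕ.n%n≡0 (suc n))
suc-%-surjective {suc i} 1+i<n = i , ℕ.<-trans (ℕ.n<1+n i) 1+i<n , sym (ℕ.m<n⇒m%n≡m 1+i<n)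

-- This keeps the two neighbours of `i` in the cycle apart: if they agreed, two steps forward would
-- lead back to `i`.
suc-%-suc-%≢ : ∀ {i n} .{{_ : ℕ.NonZero n}} → 2 < n → i < n → suc (suc i ℕ.% n) ℕ.% n ≢ i
suc-%-suc-%≢ 2<n i<n e with suc-%-cases i<n
... | inj₂ (1+i≡n , e₁) rewrite e₁ | ℕ.m<n⇒m%n≡m (ℕ.<-trans (ℕ.n<1+n 1) 2<n) | sym e =
  ℕ.<⇒≢ 2<n 1+i≡n
... | inj₁ (1+i<n , e₁) rewrite e₁ with suc-%-cases 1+i<n
...   | inj₁ (_ , e₂) = ℕ.m≢1+n+m _ (trans (sym e) e₂)
...   | inj₂ (2+i≡n , e₂) rewrite trans (sym e) e₂ = ℕ.<⇒≢ 2<n 2+i≡n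

cycle-2-regular : ∀ {n} (3≤n : 3 ≤ n) i → Graph.degree (cycle n 3≤n) i ≡ 2
cycle-2-regular {n} 3≤n i = degree≡2⁺ (cycle n 3≤n) {i} {fromℕ< next<n} {fromℕ< prev<n}
  next≢prev (inj₁ (Fin.toℕ-fromℕ< next<n))
  (inj₂ (trans i≡1+prev (cong (λ k → suc k ℕ.% n) (sym (Fin.toℕ-fromℕ< prev<n)))))
  λ { {v} → Sum.map
    (λ e → Fin.toℕ-injective (trans e (sym (Fin.toℕ-fromℕ< next<n))))
    (λ e → Fin.toℕ-injective (trans
      (suc-%-injective (Fin.toℕ<n v) prev<n (trans (sym e) i≡1+prev))
      (sym (Fin.toℕ-fromℕ< prev<n)))) }
  where
  instance
    n≢0 : ℕ.NonZero n
    n≢0 = ℕ.>-nonZero (ℕ.≤-trans (s≤s z≤n) 3≤n)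
  next<n : suc (toℕ i) ℕ.% n < n
  next<n = ℕ.m%n<n (suc (toℕ i)) n
  predecessor : ∃[ j ] j < n × toℕ i ≡ suc j ℕ.% n
  predecessor = suc-%-surjective (Fin.toℕ<n i)
  prev<n : proj₁ predecessor < n
  prev<n = proj₁ (proj₂ predecessor)
  i≡1+prev : toℕ i ≡ suc (proj₁ predecessor) ℕ.% n
  i≡1+prev = proj₂ (proj₂ predecessor)
  next≢prev : fromℕ< next<n ≢ fromℕ< prev<n
  next≢prev e = suc-%-suc-%≢ 3≤n (Fin.toℕ<n i) (trans
    (cong (λ k → suc k ℕ.% n) (Fin.fromℕ<-injective _ _ next<n prev<n e)) (sym i≡1+prev))

-- The two neighbours of the image pull back along the inverse bijection to distinct neighbours of
-- `u`, and every neighbour of `u` maps to one of the two.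
≅-degree≡2 : ∀ {n} {G H : Graph n} ((f , _) : G ≅ H) u →
             Graph.degree H (Inverse.to f u) ≡ 2 → Graph.degree G u ≡ 2
≅-degree≡2 {G = G} {H} (f , adj⇔) u d≡2 =
  let a , fu-a              = degree>0⇒adj H (subst (0 <_) (sym d≡2) z<s)
      b , fu-b , b≢a , only = degree≡2⁻ H d≡2 fu-a
  in  degree≡2⁺ G {u} {from a} {from b}
        (λ e → b≢a (trans (sym (to∘from b)) (trans (cong to (sym e)) (to∘from a))))
        (pullback fu-a) (pullback fu-b)
        λ {v} uv → Sum.map (λ e → sym (inverseʳ (sym e))) (λ e → sym (inverseʳ (sym e)))
          (only (Equivalence.to (adj⇔ u v) uv))
  where
  open Inverse f using (to; from; inverseˡ; inverseʳ)
  to∘from : ∀ v → to (from v) ≡ v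
  to∘from v = inverseˡ refl
  pullback : ∀ {v} → Graph.Adj H (to u) v → Graph.Adj G u (from v)
  pullback {v} a = Equivalence.from (adj⇔ u (from v))
    (subst (Graph.Adj H (to u)) (sym (to∘from v)) a)

-- Minimum degree and the list of edges.

connected∧nonpendent⇒degree≥2 : ∀ {n} (G : Graph n) → 2 ≤ n → Connected G → (∀ u → ¬ Pendent G u) →
                            ∀ u → 2 ≤ Graph.degree G u
connected∧nonpendent⇒degree≥2 {suc (suc n)} G _ connected nonpendent u =
  -- The first step of a path to any other vertex makes the degree positive, and it is not one.
  ℕ.≤∧≢⇒< (degree>0 (proj₂ (another u)) (connected u _)) (nonpendent u ∘ sym)
  where
  another : (u : Fin (suc (suc n))) → ∃[ v ] u ≢ v
  another Fin.zero    = Fin.suc Fin.zero , λ ()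
  another (Fin.suc _) = Fin.zero , λ ()
  degree>0 : ∀ {u v} → u ≢ v → Star (Graph.Adj G) u v → 0 < Graph.degree G u
  degree>0 u≢u ε        = contradiction refl u≢u
  degree>0 _   (uv ◅ _) = Graph.adj⇒degree>0 G uv
connected∧nonpendent⇒degree≥2 {suc zero} _ (s≤s ())

∈-toList⁺ : ∀ {A : Set} {P : A → Set} {x xs} (pxs : All P xs) → x ∈ xs →
            ∃[ px ] (x , px) ∈ All.toList pxs
∈-toList⁺ (px ∷ _)   (here refl) = px , here refl
∈-toList⁺ (_  ∷ pxs) (there x∈)  = let px , px∈ = ∈-toList⁺ pxs x∈ in px , there px∈

-- The list pairs an edge with the proof extracted from `isEdge?`, which may differ from the given
-- one; hence the existential.
∈-edges⁺ : ∀ {n} (G : Graph n) {u v} → Graph.IsEdge G (u , v) →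
           ∃[ uv ] ((u , v) , uv) ∈ Graph.edges G
∈-edges⁺ G uv = ∈-toList⁺ (all-filter isEdge? (cartesianProduct (allFin _) (allFin _)))
  (∈-filter⁺ isEdge? (∈-cartesianProduct⁺ (∈-allFin _) (∈-allFin _)) uv)
  where open Graph G

-- Sum and product of two degrees, and the edge terms.

sum≤product : ∀ {a b} → 2 ≤ a → 2 ≤ b → a ℕ.+ b ≤ a ℕ.* b
sum≤product {a} {suc b} 2≤a (s≤s 1≤b) = begin
  a ℕ.+ suc b        ≤⟨ ℕ.+-monoʳ-≤ a (ℕ.+-monoˡ-≤ b 1≤b) ⟩
  a ℕ.+ (b ℕ.+ b)    ≡⟨ cong (λ c → a ℕ.+ (b ℕ.+ c)) (ℕ.+-identityʳ b) ⟨
  a ℕ.+ 2 ℕ.* b      ≤⟨ ℕ.+-monoʳ-≤ a (ℕ.*-monoˡ-≤ b 2≤a) ⟩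
  a ℕ.+ a ℕ.* b      ≡⟨ ℕ.*-suc a b ⟨
  a ℕ.* suc b        ∎
  where open ℕ.≤-Reasoning

-- If `3 ≤ a` then, after cancelling `a`, the product exceeds the sum:
-- `1 + b ≤ b + b < 3 * b ≤ a * b`, where `suc b` is the second factor.
product≤sum⇒≡2 : ∀ {a b} → 2 ≤ a → 2 ≤ b → a ℕ.* b ≤ a ℕ.+ b → a ≡ 2
product≤sum⇒≡2 {a} {suc b} 2≤a (s≤s 1≤b) ab≤a+b with ℕ.m≤n⇒m<n∨m≡n 2≤a
... | inj₂ 2≡a = sym 2≡a
... | inj₁ 3≤a = contradiction (ℕ.+-cancelˡ-≤ a _ _ (subst (_≤ a ℕ.+ suc b) (ℕ.*-suc a b) ab≤a+b))
  (ℕ.<⇒≱ (begin-strict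
    suc b               ≤⟨ ℕ.+-monoˡ-≤ b 1≤b ⟩
    b ℕ.+ b             <⟨ ℕ.+-monoʳ-< b (ℕ.+-mono-≤ 1≤b (ℕ.m≤m+n b 0)) ⟩
    3 ℕ.* b             ≤⟨ ℕ.*-monoˡ-≤ b 3≤a ⟩
    a ℕ.* b             ∎))
  where open ℕ.≤-Reasoning

module _ {a b : ℕ} (2≤a : 2 ≤ a) (2≤b : 2 ≤ b) where

  private instance
    sum≢0 : ℕ.NonZero (a ℕ.+ b)
    sum≢0 = ℕ.>-nonZero (ℕ.≤-trans (ℕ.<-trans z<s 2≤a) (ℕ.m≤m+n a b))
    product≢0 : ℕ.NonZero (a ℕ.* b)
    product≢0 = ℕ.>-nonZero (ℕ.*-mono-≤ (ℕ.<-trans z<s 2≤a) (ℕ.<-trans z<s 2≤b))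

  private
    numerator : ℤ.ℤ
    numerator = + a ℤ.+ + b ℤ.- + 2

    instance
      -- Strict comparison of the fractions needs a numerator that is positive, not merely
      -- non-negative.
      numerator>0 : ℤ.Positive numerator
      numerator>0 = positive 2≤a 2≤b
        where
        positive : ∀ {a b} → 2 ≤ a → 2 ≤ b → ℤ.Positive (+ a ℤ.+ + b ℤ.- + 2)
        positive {suc (suc a)} {suc (suc b)} (s≤s (s≤s _)) (s≤s (s≤s _))
          rewrite ℕ.+-suc a (suc b) = _

      numerator≥0 : ℤ.NonNegative numerator
      numerator≥0 = ℤ.nonNegative (ℤ.<⇒≤ (ℤ.positive⁻¹ numerator))

  √product≤√sum : √ (numerator ℚ./ (a ℕ.* b)) ≤ᴿ √ (numerator ℚ./ (a ℕ.+ b))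
  √product≤√sum = √-mono-≤ (/-antimono-≤ numerator (sum≤product 2≤a 2≤b))

  √sum≤√product : a ℕ.* b ≤ a ℕ.+ b →
                  √ (numerator ℚ./ (a ℕ.+ b)) ≤ᴿ √ (numerator ℚ./ (a ℕ.* b))
  √sum≤√product ab≤a+b = √-mono-≤ (/-antimono-≤ numerator ab≤a+b)

  √product<√sum : a ℕ.+ b < a ℕ.* b →
                  √ (numerator ℚ./ (a ℕ.* b)) <ᴿ √ (numerator ℚ./ (a ℕ.+ b))
  √product<√sum a+b<ab =
    √-mono-< (0≤/ numerator (a ℕ.* b)) (/-antimono-< numerator a+b<ab)

-- Comparison of the two indices.

module _ {n : ℕ} (G : Graph n) (degree≥2 : ∀ u → 2 ≤ Graph.degree G u) where
  open Graph G hiding (Connected; Pendent)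

  ABC-term≤ABS-term : ∀ e → ABC-term G e ≤ᴿ ABS-term G e
  ABC-term≤ABS-term ((u , v) , _) = √product≤√sum (degree≥2 u) (degree≥2 v)

  ABC≤ABS : ABC G ≤ᴿ ABS G
  ABC≤ABS = sumᴿ-mono-≤ ABC-term≤ABS-term edges

  2-regular⇒ABS≤ABC : (∀ u → degree u ≡ 2) → ABS G ≤ᴿ ABC G
  2-regular⇒ABS≤ABC regular = sumᴿ-mono-≤ {f = ABS-term G} {g = ABC-term G}
    (λ { ((u , v) , _) → √sum≤√product (degree≥2 u) (degree≥2 v)
           (product≤sum (regular u) (regular v)) })
    edges
    where
    product≤sum : ∀ {a b} → a ≡ 2 → b ≡ 2 → a ℕ.* b ≤ a ℕ.+ b
    product≤sum refl refl = ℕ.≤-refl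

  -- One edge whose product exceeds its sum has a strictly smaller `ABC-term`, which would make the
  -- whole sum strictly smaller.
  ABS≤ABC⇒product≤sum : ABS G ≤ᴿ ABC G → ∀ {u v} → IsEdge (u , v) →
                        degree u ℕ.* degree v ≤ degree u ℕ.+ degree v
  ABS≤ABC⇒product≤sum ABS≤ABC {u} {v} uv with degree u ℕ.* degree v ℕ.≤? degree u ℕ.+ degree v
  ... | yes p≤s = p≤s
  ... | no  p≰s = contradiction (λ {q} → ABS≤ABC {q}) (<ᴿ⇒≱ᴿ (ABC G) (ABS G)
    (sumᴿ-mono-< ABC-term≤ABS-term (proj₂ (∈-edges⁺ G uv))
      (√product<√sum (degree≥2 u) (degree≥2 v) (ℕ.≰⇒> p≰s))))

  ABS≤ABC⇒2-regular : ABS G ≤ᴿ ABC G → ∀ u → degree u ≡ 2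
  ABS≤ABC⇒2-regular ABS≤ABC u with degree>0⇒adj G (ℕ.<-trans z<s (degree≥2 u))
  ... | v , uv with Fin.<-cmp u v
  ...   | tri< u<v _ _ = product≤sum⇒≡2 (degree≥2 u) (degree≥2 v)
    (ABS≤ABC⇒product≤sum ABS≤ABC (u<v , uv))
  ...   | tri≈ _ u≡v _ = contradiction uv (adj-irrefl u≡v)
  -- `edges` lists the smaller endpoint first, so here the inequality is obtained for `v` and `u`
  -- and then commuted.
  ...   | tri> _ _ v<u = product≤sum⇒≡2 (degree≥2 u) (degree≥2 v)
    (subst₂ _≤_ (ℕ.*-comm (degree v) (degree u)) (ℕ.+-comm (degree v) (degree u))
      (ABS≤ABC⇒product≤sum ABS≤ABC (v<u , adj-sym uv)))

proposition2p1 : ∀ (n : ℕ) (G : Graph n) → 2 ≤ n → Connected G → (∀ u → ¬ Pendent G u) →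
    (ABC G ≤ᴿ ABS G) × ((ABC G ≃ᴿ ABS G) ⇔ (Σ[ 3≤n ∈ 3 ≤ n ] (G ≅ cycle n 3≤n)))
proposition2p1 n G 2≤n connected nonpendent = ABC≤ABS G degree≥2 , mk⇔
  -- As `ABC ≤ ABS` always holds, equality amounts to the reverse inequality.
  (λ { (_ , ABS≤ABC) → tour⇒≅cycle G
         (2-regular⇒tour G (ABS≤ABC⇒2-regular G degree≥2 (λ {q} → ABS≤ABC {q}))
            (fromℕ< (ℕ.<-trans z<s 2≤n)))
         connected })
  (λ { (3≤n , iso) → ABC≤ABS G degree≥2 , 2-regular⇒ABS≤ABC G degree≥2
         (λ u → ≅-degree≡2 {G = G} {H = cycle n 3≤n} iso u (cycle-2-regular 3≤n _)) })
  where
  degree≥2 : ∀ u → 2 ≤ Graph.degree G u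
  degree≥2 = connected∧nonpendent⇒degree≥2 G 2≤n connected nonpendent
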